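{- Let $p$ be a prime and let $g:\mathbb{N}\to\mathbb{C}$ be an arithmetic function with Bell exponents $\beta_g(m)=\frac1m\sum_{d\mid m}\mu(d)\,g(m/d)$, $m\ge1$. Let $a_g(n)$ be the coefficients of $$F_g(x)=\exp\left(-\sum_{n\ge1}\frac{g(n)}{n}x^n\right)=\sum_{n\ge0}a_g(n)x^n.$$ If $\beta_g(m)=0$ whenever $p\nmid m$, then $a_g(n)=0$ whenever $p\nmid n$.
   Context: $\mathbb{N}$ is the set of positive integers and $\mu$ is the Möbius function. $F_g(x)\in\mathbb{C}[[x]]$ is a formal power series, called the formal Bell transform of $g$. -}

module Defs where

open import Algebra.Bundles using (CommutativeRing)
open import Algebra.Structures using (IsCommutativeRing)
open import Data.Bool.Base using (if_then_else_)
open import Data.Fin.Base using (Fin; zero; suc; toℕ)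
open import Data.Integer.Base as ℤ using (ℤ; 0ℤ; 1ℤ; -1ℤ)
open import Data.List.Base using (length)
open import Data.List.Relation.Unary.Unique.DecPropositional using (unique?)
open import Data.Nat.Base as ℕ using (ℕ; zero; suc; NonZero; _!; s≤s)
open import Data.Nat.Divisibility using (_∣?_; quotient; quotient≢0)
import Data.Nat.Properties as ℕ
open import Data.Nat.Primality.Factorisation using (factors; factorise)
open import Data.Product.Base using (∃-syntax; _×_; _,_)
open import Data.Rational.Base as ℚ using (ℚ; 0ℚ; 1ℚ; ½; ∣_∣; positive; Positive)
import Data.Rational.Properties as ℚ
open import Level using (0ℓ)
open import Relation.Binary.PropositionalEquality
  using (_≡_; refl; sym; trans; cong; subst)
open import Relation.Binary.Structures using (IsEquivalence)
open import Relation.Nullary.Decidable using (does; yes; no)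

------------------------------------------------------------------------
-- Ring identities (auxiliary)

private
  -- For an abstract ring, so that the solver never unfolds the operations of ℚ.
  -- The solver is for semirings: a variable k stands for -1.
  module Identities {c ℓ} (R : CommutativeRing c ℓ) where
    open CommutativeRing R hiding (zero)
    open import Algebra.Properties.Ring ring
    import Algebra.Solver.Ring.NaturalCoefficients.Default commutativeSemiring as Semiring
    open Semiring using (solve; _:+_; _:*_; _:=_)
    open import Relation.Binary.Reasoning.Setoid setoid

    private
      module ≈ = CommutativeRing R using (refl; sym)

      neg : ∀ x → - x ≈ - 1# * x
      neg x = ≈.sym (-1*x≈-x x)

    rearrange-+ : ∀ a b c d → (a - b) + (c - d) ≈ (a + c) - (b + d)
    rearrange-+ a b c d = begin
      (a - b) + (c - d)
        ≈⟨ solve 4 (λ a b′ c d′ → (a :+ b′) :+ (c :+ d′) := (a :+ c) :+ (b′ :+ d′))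
             ≈.refl a (- b) c (- d) ⟩
      (a + c) + (- b - d)  ≈⟨ +-congˡ (-‿+-comm b d) ⟩
      (a + c) - (b + d)    ∎

    rearrange-neg : ∀ a b → - (a - b) ≈ - a - - b
    rearrange-neg a b = ≈.sym (-‿+-comm a (- b))

    cancel : ∀ a b → (a - b) + b ≈ a
    cancel a b = begin
      (a - b) + b    ≈⟨ +-assoc a (- b) b ⟩
      a + (- b + b)  ≈⟨ +-congˡ (-‿inverseˡ b) ⟩
      a + 0#         ≈⟨ +-identityʳ a ⟩
      a              ∎

    telescope : ∀ a b c → (a - b) + (b - c) ≈ a - c
    telescope a b c = begin
      (a - b) + (b - c)  ≈⟨ +-assoc (a - b) b (- c) ⟨
      ((a - b) + b) - c  ≈⟨ +-congʳ (cancel a b) ⟩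
      a - c              ∎

    flip-neg : ∀ a b → - (a - b) ≈ b - a
    flip-neg a b = begin
      - (a - b)    ≈⟨ rearrange-neg a b ⟩
      - a - - b    ≈⟨ +-congˡ (-‿involutive b) ⟩
      - a + b      ≈⟨ +-comm (- a) b ⟩
      b - a        ∎

    private
      rearrange-*′ : ∀ k a b c d →
        a * (c + k * d) + d * (a + k * b) ≈
        (a * c + k * (a * d)) + (a * d + k * (b * d))
      rearrange-*′ = solve 5 (λ k a b c d →
        a :* (c :+ k :* d) :+ d :* (a :+ k :* b) :=
        (a :* c :+ k :* (a :* d)) :+ (a :* d :+ k :* (b :* d))) ≈.refl

    rearrange-* : ∀ a b c d → a * (c - d) + d * (a - b) ≈ a * c - b * d
    rearrange-* a b c d = begin
      a * (c - d) + d * (a - b)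
        ≈⟨ +-cong (*-congˡ (+-congˡ (neg d))) (*-congˡ (+-congˡ (neg b))) ⟩
      a * (c + - 1# * d) + d * (a + - 1# * b)
        ≈⟨ rearrange-*′ (- 1#) a b c d ⟩
      (a * c + - 1# * (a * d)) + (a * d + - 1# * (b * d))
        ≈⟨ +-cong (+-congˡ (neg (a * d))) (+-congˡ (neg (b * d))) ⟨
      (a * c - a * d) + (a * d - b * d)
        ≈⟨ telescope (a * c) (a * d) (b * d) ⟩
      a * c - b * d ∎

    comm-re : ∀ a b c d → a * c - b * d ≈ c * a - d * b
    comm-re a b c d = +-cong (*-comm a c) (-‿cong (*-comm b d))

    comm-im : ∀ a b c d → a * d + b * c ≈ c * b + d * a
    comm-im = solve 4 (λ a b c d → a :* d :+ b :* c := c :* b :+ d :* a) ≈.refl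

    private
      assoc-re′ : ∀ k a b c d e f →
        (a * c + k * (b * d)) * e + k * ((a * d + b * c) * f) ≈
        a * (c * e + k * (d * f)) + k * (b * (c * f + d * e))
      assoc-re′ = solve 7 (λ k a b c d e f →
        (a :* c :+ k :* (b :* d)) :* e :+ k :* ((a :* d :+ b :* c) :* f) :=
        a :* (c :* e :+ k :* (d :* f)) :+ k :* (b :* (c :* f :+ d :* e))) ≈.refl

      assoc-im′ : ∀ k a b c d e f →
        (a * c + k * (b * d)) * f + (a * d + b * c) * e ≈
        a * (c * f + d * e) + b * (c * e + k * (d * f))
      assoc-im′ = solve 7 (λ k a b c d e f →
        (a :* c :+ k :* (b :* d)) :* f :+ (a :* d :+ b :* c) :* e :=
        a :* (c :* f :+ d :* e) :+ b :* (c :* e :+ k :* (d :* f))) ≈.refl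

    assoc-re : ∀ a b c d e f →
      (a * c - b * d) * e - (a * d + b * c) * f ≈
      a * (c * e - d * f) - b * (c * f + d * e)
    assoc-re a b c d e f = begin
      (a * c - b * d) * e - (a * d + b * c) * f
        ≈⟨ +-cong (*-congʳ (+-congˡ (neg (b * d)))) (neg ((a * d + b * c) * f)) ⟩
      (a * c + - 1# * (b * d)) * e + - 1# * ((a * d + b * c) * f)
        ≈⟨ assoc-re′ (- 1#) a b c d e f ⟩
      a * (c * e + - 1# * (d * f)) + - 1# * (b * (c * f + d * e))
        ≈⟨ +-cong (*-congˡ (+-congˡ (neg (d * f)))) (neg (b * (c * f + d * e))) ⟨
      a * (c * e - d * f) - b * (c * f + d * e) ∎

    assoc-im : ∀ a b c d e f →
      (a * c - b * d) * f + (a * d + b * c) * e ≈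
      a * (c * f + d * e) + b * (c * e - d * f)
    assoc-im a b c d e f = begin
      (a * c - b * d) * f + (a * d + b * c) * e
        ≈⟨ +-congʳ (*-congʳ (+-congˡ (neg (b * d)))) ⟩
      (a * c + - 1# * (b * d)) * f + (a * d + b * c) * e
        ≈⟨ assoc-im′ (- 1#) a b c d e f ⟩
      a * (c * f + d * e) + b * (c * e + - 1# * (d * f))
        ≈⟨ +-congˡ (*-congˡ (+-congˡ (neg (d * f)))) ⟨
      a * (c * f + d * e) + b * (c * e - d * f) ∎

    distrib-re : ∀ a b c d e f →
      a * (c + e) - b * (d + f) ≈ (a * c - b * d) + (a * e - b * f)
    distrib-re a b c d e f = begin
      a * (c + e) - b * (d + f)
        ≈⟨ +-cong (distribˡ a c e) (-‿cong (distribˡ b d f)) ⟩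
      (a * c + a * e) - (b * d + b * f)
        ≈⟨ rearrange-+ (a * c) (b * d) (a * e) (b * f) ⟨
      (a * c - b * d) + (a * e - b * f) ∎

    distrib-im : ∀ a b c d e f →
      a * (d + f) + b * (c + e) ≈ (a * d + b * c) + (a * f + b * e)
    distrib-im = solve 6 (λ a b c d e f →
      a :* (d :+ f) :+ b :* (c :+ e) :=
      (a :* d :+ b :* c) :+ (a :* f :+ b :* e)) ≈.refl

    identity-re : ∀ a b → 1# * a - 0# * b ≈ a
    identity-re a b = begin
      1# * a - 0# * b  ≈⟨ +-cong (*-identityˡ a) (-‿cong (zeroˡ b)) ⟩
      a - 0#           ≈⟨ +-congˡ -0#≈0# ⟩
      a + 0#           ≈⟨ +-identityʳ a ⟩
      a                ∎

    identity-im : ∀ a b → 1# * b + 0# * a ≈ b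
    identity-im a b = begin
      1# * b + 0# * a  ≈⟨ +-cong (*-identityˡ b) (zeroˡ a) ⟩
      b + 0#           ≈⟨ +-identityʳ b ⟩
      b                ∎

    scalar-im : ∀ a b → a * 0# + 0# * b ≈ 0#
    scalar-im a b = begin
      a * 0# + 0# * b  ≈⟨ +-cong (zeroʳ a) (zeroˡ b) ⟩
      0# + 0#          ≈⟨ +-identityˡ 0# ⟩
      0#               ∎

  module I = Identities ℚ.+-*-commutativeRing

------------------------------------------------------------------------
-- Eventual smallness of rational double sequences (auxiliary)

private
  Small : (ℕ → ℕ → ℚ) → Set
  Small f = ∀ ε → 0ℚ ℚ.< ε →
            ∃[ N ] (∀ m n → N ℕ.≤ m → N ℕ.≤ n → ∣ f m n ∣ ℚ.< ε)

  Bounded : (ℕ → ℕ → ℚ) → Set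
  Bounded f = ∃[ B ] 0ℚ ℚ.< B ×
              ∃[ N ] (∀ m n → N ℕ.≤ m → N ℕ.≤ n → ∣ f m n ∣ ℚ.≤ B)

  abstract
    small-cong : ∀ {f g} → (∀ m n → f m n ≡ g m n) → Small f → Small g
    small-cong f≡g s ε ε>0 with s ε ε>0
    ... | N , h = N , λ m n p q → subst (λ z → ∣ z ∣ ℚ.< ε) (f≡g m n) (h m n p q)

    small-0 : ∀ {f} → (∀ m n → f m n ≡ 0ℚ) → Small f
    small-0 f≡0 = small-cong (λ m n → sym (f≡0 m n)) λ ε ε>0 → 0 , λ _ _ _ _ → ε>0

    small-neg : ∀ {f} → Small f → Small (λ m n → ℚ.- f m n)
    small-neg {f} s ε ε>0 with s ε ε>0
    ... | N , h = N , λ m n p q →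
      subst (ℚ._< ε) (sym (ℚ.∣-p∣≡∣p∣ (f m n))) (h m n p q)

    small-+ : ∀ {f g} → Small f → Small g → Small (λ m n → f m n ℚ.+ g m n)
    small-+ {f} {g} s t ε ε>0 = go (s δ δ>0) (t δ δ>0)
      where
      δ : ℚ
      δ = ½ ℚ.* ε
      δ>0 : 0ℚ ℚ.< δ
      δ>0 = ℚ.positive⁻¹ δ {{ℚ.pos*pos⇒pos ½ ε {{positive ε>0}}}}
      δ+δ≡ε : δ ℚ.+ δ ≡ ε
      δ+δ≡ε = trans (sym (ℚ.*-distribʳ-+ ε ½ ½)) (ℚ.*-identityˡ ε)
      go : ∃[ N ] (∀ m n → N ℕ.≤ m → N ℕ.≤ n → ∣ f m n ∣ ℚ.< δ) →
           ∃[ N ] (∀ m n → N ℕ.≤ m → N ℕ.≤ n → ∣ g m n ∣ ℚ.< δ) →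
           ∃[ N ] (∀ m n → N ℕ.≤ m → N ℕ.≤ n → ∣ f m n ℚ.+ g m n ∣ ℚ.< ε)
      go (M , h) (N , k) = M ℕ.⊔ N , λ m n p q →
        ℚ.≤-<-trans (ℚ.∣p+q∣≤∣p∣+∣q∣ (f m n) (g m n))
          (subst (∣ f m n ∣ ℚ.+ ∣ g m n ∣ ℚ.<_) δ+δ≡ε
            (ℚ.+-mono-<
              (h m n (ℕ.m⊔n≤o⇒m≤o M N p) (ℕ.m⊔n≤o⇒m≤o M N q))
              (k m n (ℕ.m⊔n≤o⇒n≤o M N p) (ℕ.m⊔n≤o⇒n≤o M N q))))

    small-* : ∀ {b f} → Bounded b → Small f → Small (λ m n → b m n ℚ.* f m n)
    small-* {b} {f} (B , B>0 , M , bd) s ε ε>0 = go (s δ δ>0)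
      where
      instance
        B-pos : Positive B
        B-pos = positive B>0
        B-nonZero : ℚ.NonZero B
        B-nonZero = ℚ.pos⇒nonZero B
        B-nonNeg : ℚ.NonNegative B
        B-nonNeg = ℚ.pos⇒nonNeg B
      δ : ℚ
      δ = (ℚ.1/ B) ℚ.* ε
      δ>0 : 0ℚ ℚ.< δ
      δ>0 = ℚ.positive⁻¹ δ
              {{ℚ.pos*pos⇒pos (ℚ.1/ B) {{ℚ.1/pos⇒pos B}} ε {{positive ε>0}}}}
      Bδ≡ε : B ℚ.* δ ≡ ε
      Bδ≡ε = trans (sym (ℚ.*-assoc B (ℚ.1/ B) ε))
               (trans (cong (ℚ._* ε) (ℚ.*-inverseʳ B)) (ℚ.*-identityˡ ε))
      go : ∃[ N ] (∀ m n → N ℕ.≤ m → N ℕ.≤ n → ∣ f m n ∣ ℚ.< δ) →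
           ∃[ N ] (∀ m n → N ℕ.≤ m → N ℕ.≤ n → ∣ b m n ℚ.* f m n ∣ ℚ.< ε)
      go (N , h) = M ℕ.⊔ N , λ m n p q →
        subst (ℚ._< ε) (sym (ℚ.∣p*q∣≡∣p∣*∣q∣ (b m n) (f m n)))
          (ℚ.≤-<-trans
            (ℚ.*-monoʳ-≤-nonNeg ∣ f m n ∣ {{ℚ.∣-∣-nonNeg (f m n)}}
              (bd m n (ℕ.m⊔n≤o⇒m≤o M N p) (ℕ.m⊔n≤o⇒m≤o M N q)))
            (subst (B ℚ.* ∣ f m n ∣ ℚ.<_) Bδ≡ε
              (ℚ.*-monoʳ-<-pos B
                (h m n (ℕ.m⊔n≤o⇒n≤o M N p) (ℕ.m⊔n≤o⇒n≤o M N q)))))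

------------------------------------------------------------------------
-- The real numbers, as Cauchy sequences of rationals up to null sequences
--
-- no-eta-equality and copatterns keep conversion checking from unfolding
-- the arithmetic of ℝ and ℂ down to that of ℚ.

IsCauchy : (ℕ → ℚ) → Set
IsCauchy s = ∀ ε → 0ℚ ℚ.< ε →
  ∃[ N ] (∀ m n → N ℕ.≤ m → N ℕ.≤ n → ∣ s m ℚ.- s n ∣ ℚ.< ε)

record ℝ : Set where
  no-eta-equality
  field
    seq    : ℕ → ℚ
    cauchy : IsCauchy seq

open ℝ public

infix 4 _≈ℝ_

record _≈ℝ_ (x y : ℝ) : Set where
  constructor mk≈
  field
    null : ∀ ε → 0ℚ ℚ.< ε →
           ∃[ N ] (∀ n → N ℕ.≤ n → ∣ seq x n ℚ.- seq y n ∣ ℚ.< ε)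

open _≈ℝ_ public

private
  abstract
    toSmall : ∀ {x y} → x ≈ℝ y → Small (λ m _ → seq x m ℚ.- seq y m)
    toSmall (mk≈ e) ε ε>0 with e ε ε>0
    ... | N , h = N , λ m _ p _ → h m p

    fromSmall : ∀ {x y} → Small (λ m _ → seq x m ℚ.- seq y m) → x ≈ℝ y
    fromSmall s .null ε ε>0 with s ε ε>0
    ... | N , h = N , λ n p → h n n p p

    boundedˡ : ∀ x → Bounded (λ m _ → seq x m)
    boundedˡ x with cauchy x 1ℚ (ℚ.positive⁻¹ 1ℚ)
    ... | N , h = 1ℚ ℚ.+ ∣ c ∣
                , ℚ.positive⁻¹ _ {{ℚ.pos+nonNeg⇒pos 1ℚ ∣ c ∣ {{ℚ.∣-∣-nonNeg c}}}}
                , N , bd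
      where
      c : ℚ
      c = seq x N
      bd : ∀ m n → N ℕ.≤ m → N ℕ.≤ n → ∣ seq x m ∣ ℚ.≤ 1ℚ ℚ.+ ∣ c ∣
      bd m _ p _ = subst (λ z → ∣ z ∣ ℚ.≤ 1ℚ ℚ.+ ∣ c ∣)
        (I.cancel (seq x m) c)
        (ℚ.≤-trans (ℚ.∣p+q∣≤∣p∣+∣q∣ (seq x m ℚ.- c) c)
          (ℚ.+-monoˡ-≤ ∣ c ∣ (ℚ.<⇒≤ (h m N p ℕ.≤-refl))))

    boundedʳ : ∀ x → Bounded (λ _ n → seq x n)
    boundedʳ x with boundedˡ x
    ... | B , B>0 , N , h = B , B>0 , N , λ m n p q → h n m q p

fromℚℝ : ℚ → ℝ
(fromℚℝ q) .seq _ = q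
(fromℚℝ q) .cauchy = cauchy′
  where
  abstract
    cauchy′ : IsCauchy (λ _ → q)
    cauchy′ = small-0 (λ _ _ → ℚ.+-inverseʳ q)

infixl 6 _+ℝ_
infixl 7 _*ℝ_
infix  8 -ℝ_

_+ℝ_ : ℝ → ℝ → ℝ
(x +ℝ y) .seq n = seq x n ℚ.+ seq y n
(x +ℝ y) .cauchy = cauchy′
  where
  abstract
    cauchy′ : IsCauchy (λ n → seq x n ℚ.+ seq y n)
    cauchy′ = small-cong
      (λ m n → I.rearrange-+ (seq x m) (seq x n) (seq y m) (seq y n))
      (small-+ (cauchy x) (cauchy y))

-ℝ_ : ℝ → ℝ
(-ℝ x) .seq n = ℚ.- seq x n
(-ℝ x) .cauchy = cauchy′
  where
  abstract
    cauchy′ : IsCauchy (λ n → ℚ.- seq x n)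
    cauchy′ = small-cong
      (λ m n → I.rearrange-neg (seq x m) (seq x n))
      (small-neg (cauchy x))

_*ℝ_ : ℝ → ℝ → ℝ
(x *ℝ y) .seq n = seq x n ℚ.* seq y n
(x *ℝ y) .cauchy = cauchy′
  where
  abstract
    cauchy′ : IsCauchy (λ n → seq x n ℚ.* seq y n)
    cauchy′ = small-cong
      (λ m n → I.rearrange-* (seq x m) (seq x n) (seq y m) (seq y n))
      (small-+ (small-* (boundedˡ x) (cauchy y)) (small-* (boundedʳ y) (cauchy x)))

private
  abstract
    ≡⇒≈ℝ : ∀ {x y} → (∀ n → seq x n ≡ seq y n) → x ≈ℝ y
    ≡⇒≈ℝ {x} {y} e = fromSmall (small-0 (λ m _ →
      trans (cong (ℚ._- seq y m) (e m)) (ℚ.+-inverseʳ (seq y m))))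

    symℝ : ∀ {x y} → x ≈ℝ y → y ≈ℝ x
    symℝ {x} {y} e = fromSmall (small-cong
      (λ m _ → I.flip-neg (seq x m) (seq y m))
      (small-neg (toSmall e)))

    transℝ : ∀ {x y z} → x ≈ℝ y → y ≈ℝ z → x ≈ℝ z
    transℝ {x} {y} {z} e f = fromSmall (small-cong
      (λ m _ → I.telescope (seq x m) (seq y m) (seq z m))
      (small-+ (toSmall e) (toSmall f)))

    +ℝ-cong : ∀ {x x′ y y′} → x ≈ℝ x′ → y ≈ℝ y′ → x +ℝ y ≈ℝ x′ +ℝ y′
    +ℝ-cong {x} {x′} {y} {y′} e f = fromSmall (small-cong
      (λ m _ → I.rearrange-+ (seq x m) (seq x′ m) (seq y m) (seq y′ m))
      (small-+ (toSmall e) (toSmall f)))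

    -ℝ-cong : ∀ {x y} → x ≈ℝ y → -ℝ x ≈ℝ -ℝ y
    -ℝ-cong {x} {y} e = fromSmall (small-cong
      (λ m _ → I.rearrange-neg (seq x m) (seq y m))
      (small-neg (toSmall e)))

    *ℝ-cong : ∀ {x x′ y y′} → x ≈ℝ x′ → y ≈ℝ y′ → x *ℝ y ≈ℝ x′ *ℝ y′
    *ℝ-cong {x} {x′} {y} {y′} e f = fromSmall (small-cong
      (λ m _ → I.rearrange-* (seq x m) (seq x′ m) (seq y m) (seq y′ m))
      (small-+ (small-* (boundedˡ x) (toSmall f)) (small-* (boundedˡ y′) (toSmall e))))

private
  abstract
    ℝ-isCommutativeRing : IsCommutativeRing _≈ℝ_ _+ℝ_ _*ℝ_ -ℝ_ (fromℚℝ 0ℚ) (fromℚℝ 1ℚ)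
    ℝ-isCommutativeRing = record
      { isRing = record
        { +-isAbelianGroup = record
          { isGroup = record
            { isMonoid = record
              { isSemigroup = record
                { isMagma = record
                  { isEquivalence = record
                    { refl  = λ {x} → ≡⇒≈ℝ {x} {x} (λ _ → refl)
                    ; sym   = symℝ
                    ; trans = transℝ
                    }
                  ; ∙-cong = +ℝ-cong
                  }
                ; assoc = λ x y z → ≡⇒≈ℝ (λ n → ℚ.+-assoc (seq x n) (seq y n) (seq z n))
                }
              ; identity = (λ x → ≡⇒≈ℝ (λ n → ℚ.+-identityˡ (seq x n)))
                         , (λ x → ≡⇒≈ℝ (λ n → ℚ.+-identityʳ (seq x n)))
              }
            ; inverse = (λ x → ≡⇒≈ℝ (λ n → ℚ.+-inverseˡ (seq x n)))
                      , (λ x → ≡⇒≈ℝ (λ n → ℚ.+-inverseʳ (seq x n)))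
            ; ⁻¹-cong = -ℝ-cong
            }
          ; comm = λ x y → ≡⇒≈ℝ (λ n → ℚ.+-comm (seq x n) (seq y n))
          }
        ; *-cong = *ℝ-cong
        ; *-assoc = λ x y z → ≡⇒≈ℝ (λ n → ℚ.*-assoc (seq x n) (seq y n) (seq z n))
        ; *-identity = (λ x → ≡⇒≈ℝ (λ n → ℚ.*-identityˡ (seq x n)))
                     , (λ x → ≡⇒≈ℝ (λ n → ℚ.*-identityʳ (seq x n)))
        ; distrib = (λ x y z → ≡⇒≈ℝ (λ n → ℚ.*-distribˡ-+ (seq x n) (seq y n) (seq z n)))
                  , (λ x y z → ≡⇒≈ℝ (λ n → ℚ.*-distribʳ-+ (seq x n) (seq y n) (seq z n)))
        }
      ; *-comm = λ x y → ≡⇒≈ℝ (λ n → ℚ.*-comm (seq x n) (seq y n))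
      }

ℝ-commutativeRing : CommutativeRing 0ℓ 0ℓ
ℝ-commutativeRing = record { isCommutativeRing = ℝ-isCommutativeRing }

private
  module ℝ′ = CommutativeRing ℝ-commutativeRing
  module J = Identities ℝ-commutativeRing

------------------------------------------------------------------------
-- The complex numbers, with _≈_ as their equality

record ℂ : Set where
  no-eta-equality
  field
    re im : ℝ

open ℂ public

infix 4 _≈_

record _≈_ (z w : ℂ) : Set where
  constructor _,_
  field
    re-≈ : re z ≈ℝ re w
    im-≈ : im z ≈ℝ im w

open _≈_ public

fromℚ : ℚ → ℂ
fromℚ q .re = fromℚℝ q
fromℚ q .im = fromℚℝ 0ℚ

0ℂ 1ℂ : ℂ
0ℂ = fromℚ 0ℚ
1ℂ = fromℚ 1ℚ

infixl 6 _+_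
infixl 7 _*_
infix  8 -_

_+_ _*_ : ℂ → ℂ → ℂ
(z + w) .re = re z +ℝ re w
(z + w) .im = im z +ℝ im w
(z * w) .re = re z *ℝ re w +ℝ -ℝ (im z *ℝ im w)
(z * w) .im = re z *ℝ im w +ℝ im z *ℝ re w

-_ : ℂ → ℂ
(- z) .re = -ℝ re z
(- z) .im = -ℝ im z

private
  abstract
    *-comm : ∀ x y → x * y ≈ y * x
    *-comm x y =
      J.comm-re (re x) (im x) (re y) (im y) , J.comm-im (re x) (im x) (re y) (im y)

    ℂ-isCommutativeRing : IsCommutativeRing _≈_ _+_ _*_ -_ 0ℂ 1ℂ
    ℂ-isCommutativeRing = record
      { isRing = record
        { +-isAbelianGroup = record
          { isGroup = record
            { isMonoid = record
              { isSemigroup = record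
                { isMagma = record
                  { isEquivalence = isEquivalence
                  ; ∙-cong = +-cong
                  }
                ; assoc = λ x y z →
                    ℝ′.+-assoc (re x) (re y) (re z) , ℝ′.+-assoc (im x) (im y) (im z)
                }
              ; identity = (λ x → ℝ′.+-identityˡ (re x) , ℝ′.+-identityˡ (im x))
                         , (λ x → ℝ′.+-identityʳ (re x) , ℝ′.+-identityʳ (im x))
              }
            ; inverse = (λ x → ℝ′.-‿inverseˡ (re x) , ℝ′.-‿inverseˡ (im x))
                      , (λ x → ℝ′.-‿inverseʳ (re x) , ℝ′.-‿inverseʳ (im x))
            ; ⁻¹-cong = λ (p , q) → ℝ′.-‿cong p , ℝ′.-‿cong q
            }
          ; comm = λ x y → ℝ′.+-comm (re x) (re y) , ℝ′.+-comm (im x) (im y)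
          }
        ; *-cong = λ (p , q) (r , s) →
            ℝ′.+-cong (ℝ′.*-cong p r) (ℝ′.-‿cong (ℝ′.*-cong q s)) ,
            ℝ′.+-cong (ℝ′.*-cong p s) (ℝ′.*-cong q r)
        ; *-assoc = λ x y z →
            J.assoc-re (re x) (im x) (re y) (im y) (re z) (im z) ,
            J.assoc-im (re x) (im x) (re y) (im y) (re z) (im z)
        ; *-identity = *-identityˡ , λ x → ≈.trans (*-comm x 1ℂ) (*-identityˡ x)
        ; distrib = distribˡ , λ x y z →
            ≈.trans (*-comm (y + z) x)
              (≈.trans (distribˡ x y z) (+-cong (*-comm x y) (*-comm x z)))
        }
      ; *-comm = *-comm
      }
      where
      isEquivalence : IsEquivalence _≈_
      isEquivalence = record
        { refl  = ℝ′.refl , ℝ′.refl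
        ; sym   = λ (p , q) → ℝ′.sym p , ℝ′.sym q
        ; trans = λ (p , q) (r , s) → ℝ′.trans p r , ℝ′.trans q s
        }
      module ≈ = IsEquivalence isEquivalence

      +-cong : ∀ {x y u v} → x ≈ y → u ≈ v → x + u ≈ y + v
      +-cong (p , q) (r , s) = ℝ′.+-cong p r , ℝ′.+-cong q s

      *-identityˡ : ∀ x → 1ℂ * x ≈ x
      *-identityˡ x = J.identity-re (re x) (im x) , J.identity-im (re x) (im x)

      distribˡ : ∀ x y z → x * (y + z) ≈ x * y + x * z
      distribˡ x y z =
        J.distrib-re (re x) (im x) (re y) (im y) (re z) (im z) ,
        J.distrib-im (re x) (im x) (re y) (im y) (re z) (im z)

ℂ-commutativeRing : CommutativeRing 0ℓ 0ℓ
ℂ-commutativeRing = record { isCommutativeRing = ℂ-isCommutativeRing }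

abstract
  fromℚ-+ : ∀ p q → fromℚ (p ℚ.+ q) ≈ fromℚ p + fromℚ q
  fromℚ-+ p q = ≡⇒≈ℝ (λ _ → refl) , ≡⇒≈ℝ (λ _ → refl)

  fromℚ-* : ∀ p q → fromℚ (p ℚ.* q) ≈ fromℚ p * fromℚ q
  fromℚ-* p q =
    ≡⇒≈ℝ (λ _ → sym (ℚ.+-identityʳ (p ℚ.* q))) , ≡⇒≈ℝ (λ _ → sym (I.scalar-im p q))

private
  module R = CommutativeRing ℂ-commutativeRing

open import Algebra.Properties.CommutativeMonoid.Sum R.+-commutativeMonoid public
  using (sum)
open import Algebra.Properties.Ring R.ring using (-0#≈0#)

------------------------------------------------------------------------
-- Arithmetic functions

-- factors (factorise n) lists the prime factors of n with multiplicity
μ : (n : ℕ) → .{{NonZero n}} → ℤ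
μ n = if does (unique? ℕ._≟_ (factors (factorise n)))
      then -1ℤ ℤ.^ length (factors (factorise n))
      else 0ℤ

ArithmeticFunction : Set
ArithmeticFunction = (n : ℕ) → .{{NonZero n}} → ℂ

-- f(d, m/d) if d ∣ m, and 0 otherwise; quotient d∣m is m/d
divisorTerm : (m : ℕ) → .{{NonZero m}} →
              ((d e : ℕ) → .{{NonZero d}} → .{{NonZero e}} → ℂ) →
              (d : ℕ) → .{{NonZero d}} → ℂ
divisorTerm m f d with d ∣? m
... | yes d∣m = let instance _ = quotient≢0 d∣m in f d (quotient d∣m)
... | no  _   = 0ℂ

-- ∑_{d ∣ m} f(d, m/d), with d ranging over 1, …, m
∑-divisors : (m : ℕ) → .{{NonZero m}} →
             ((d e : ℕ) → .{{NonZero d}} → .{{NonZero e}} → ℂ) → ℂ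
∑-divisors m f = sum {m} λ i → divisorTerm m f (suc (toℕ i))

β : ArithmeticFunction → (m : ℕ) → .{{NonZero m}} → ℂ
β g m = fromℚ (1ℤ ℚ./ m) * ∑-divisors m (λ d e → fromℚ (μ d ℚ./ 1) * g e)

------------------------------------------------------------------------
-- Formal power series, given by their coefficients

ℂ⟦x⟧ : Set
ℂ⟦x⟧ = ℕ → ℂ

infixl 7 _⊛_
infixr 8 _^_

1⟦x⟧ : ℂ⟦x⟧
1⟦x⟧ zero    = 1ℂ
1⟦x⟧ (suc _) = 0ℂ

_⊛_ : ℂ⟦x⟧ → ℂ⟦x⟧ → ℂ⟦x⟧
(f ⊛ h) n = sum {suc n} λ i → f (toℕ i) * h (n ℕ.∸ toℕ i)

_^_ : ℂ⟦x⟧ → ℕ → ℂ⟦x⟧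
f ^ zero  = 1⟦x⟧
f ^ suc k = f ⊛ (f ^ k)

private
  abstract
    sum-zero : ∀ {n} (t : Fin n → ℂ) → (∀ i → t i ≈ 0ℂ) → sum t ≈ 0ℂ
    sum-zero {zero}  t t≈0 = R.refl
    sum-zero {suc n} t t≈0 =
      R.trans (R.+-cong (t≈0 zero) (sum-zero (λ i → t (suc i)) (λ i → t≈0 (suc i))))
              (R.+-identityˡ 0ℂ)

abstract
  ^-order : ∀ {f} → f 0 ≈ 0ℂ → ∀ {n k} → n ℕ.< k → (f ^ k) n ≈ 0ℂ
  ^-order {f} f₀≈0 {n} {suc k} (s≤s n≤k) =
    sum-zero (λ (i : Fin (suc n)) → f (toℕ i) * (f ^ k) (n ℕ.∸ toℕ i)) (term n≤k)
    where
    term : ∀ {n} → n ℕ.≤ k → (i : Fin (suc n)) →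
           f (toℕ i) * (f ^ k) (n ℕ.∸ toℕ i) ≈ 0ℂ
    term _ zero = R.trans (R.*-congʳ f₀≈0) (R.zeroˡ _)
    term {suc n} n<k (suc j) =
      R.trans (R.*-congˡ (^-order {f} f₀≈0 (ℕ.≤-<-trans (ℕ.m∸n≤m n (toℕ j)) n<k)))
              (R.zeroʳ _)

-- The coefficient of xⁿ in ∑_{k ≥ 0} fᵏ / k!.  As f has zero constant term, the
-- terms with k > n do not contribute (^-order), so the sum stops at k = n.
exp : (f : ℂ⟦x⟧) → f 0 ≈ 0ℂ → ℂ⟦x⟧
exp f _ n = sum {suc n} λ k → fromℚ ((1ℤ ℚ./ (toℕ k !)) {{toℕ k ℕ.!≢0}}) * (f ^ toℕ k) n

-- - ∑_{n ≥ 1} (g(n) / n) xⁿ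
exponent : ArithmeticFunction → ℂ⟦x⟧
exponent g zero      = - 0ℂ
exponent g n@(suc _) = - (fromℚ (1ℤ ℚ./ n) * g n)

F : ArithmeticFunction → ℂ⟦x⟧
F g = exp (exponent g) -0#≈0#

a : ArithmeticFunction → ℕ → ℂ
a g n = F g n

{-# OPTIONS --safe #-}
-- With β_g(m) = 0, the μ(1) term isolates g(m) as a combination of the values of g at
-- proper divisors of m.  These are again prime to p when m is, so g vanishes off the
-- multiples of p by strong induction.  Power series supported on the multiples of p are
-- closed under products and linear combinations, hence under exp.
module Submission where

open import Defs
open import Algebra.Bundles using (CommutativeRing)
open import Data.Fin.Base using (Fin; suc; toℕ)
open import Data.Fin.Properties using (toℕ≤pred[n])
open import Data.Integer.Base using (1ℤ)
open import Data.Nat.Base as ℕ using (ℕ; zero; suc; NonZero; NonTrivial; _<_; _!)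
open import Data.Nat.Divisibility
  using (_∣_; _∣?_; divides; quotient≢0; quotient-<; quotient-∣; _∣0; 1∣_; ∣-trans; ∣m∣n⇒∣m+n)
open import Data.Nat.Induction using (<-rec)
open import Data.Nat.Primality using (Prime)
import Data.Nat.Properties as ℕ
import Data.Rational.Base as ℚ
import Data.Rational.Properties as ℚ
open import Relation.Binary.PropositionalEquality as ≡ using (_≡_)
open import Relation.Nullary.Decidable using (yes; no)
open import Relation.Nullary.Negation using (¬_; contradiction)

open CommutativeRing ℂ-commutativeRing
  using (setoid; ring; +-commutativeMonoid; +-congˡ; +-identityʳ;
         *-congˡ; *-congʳ; *-identityˡ; *-assoc; zeroˡ; zeroʳ; -‿cong)
  renaming (refl to ≈-refl; sym to ≈-sym; trans to ≈-trans)
open import Algebra.Properties.CommutativeMonoid.Sum +-commutativeMonoid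
  using (sum-cong-≋; sum-replicate-zero)
open import Algebra.Properties.Ring ring using (-0#≈0#)
open import Relation.Binary.Reasoning.Setoid setoid

sum-zero : ∀ {n} (t : Fin n → ℂ) → (∀ i → t i ≈ 0ℂ) → sum t ≈ 0ℂ
sum-zero {n} t t≈0 = ≈-trans (sum-cong-≋ {n} {t} {λ _ → 0ℂ} t≈0) (sum-replicate-zero n)

*-zeroʳ : ∀ x {y} → y ≈ 0ℂ → x * y ≈ 0ℂ
*-zeroʳ x y≈0 = ≈-trans (*-congˡ y≈0) (zeroʳ x)

*-zeroˡ : ∀ {x} y → x ≈ 0ℂ → x * y ≈ 0ℂ
*-zeroˡ y x≈0 = ≈-trans (*-congʳ x≈0) (zeroˡ y)

-- The inverse is taken among the rationals and carried over by multiplicativity of `fromℚ`. This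
-- serves to strip the factor 1/m from `β g m`.
fromℚ-*-cancelˡ-≈0 : ∀ q .{{_ : ℚ.NonZero q}} {z} → fromℚ q * z ≈ 0ℂ → z ≈ 0ℂ
fromℚ-*-cancelˡ-≈0 q {z} q*z≈0 = begin
  z                                ≈⟨ *-identityˡ z ⟨
  fromℚ ℚ.1ℚ * z                   ≡⟨ ≡.cong (λ r → fromℚ r * z) (ℚ.*-inverseˡ q) ⟨
  fromℚ ((ℚ.1/ q) ℚ.* q) * z       ≈⟨ *-congʳ (fromℚ-* (ℚ.1/ q) q) ⟩
  (fromℚ (ℚ.1/ q) * fromℚ q) * z   ≈⟨ *-assoc _ _ z ⟩
  fromℚ (ℚ.1/ q) * (fromℚ q * z)   ≈⟨ *-zeroʳ _ q*z≈0 ⟩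
  0ℂ                               ∎

1/m≢0 : ∀ m .{{_ : NonZero m}} → ℚ.NonZero (1ℤ ℚ./ m)
1/m≢0 m = ℚ.pos⇒nonZero (1ℤ ℚ./ m) {{ℚ.normalize-pos 1 m}}

module _ (p : ℕ) where

  SupportedOnMultiples : ℂ⟦x⟧ → Set
  SupportedOnMultiples f = ∀ n → ¬ p ∣ n → f n ≈ 0ℂ

  1-supported : SupportedOnMultiples 1⟦x⟧
  1-supported zero    p∤0 = contradiction (p ∣0) p∤0
  1-supported (suc _) _   = ≈-refl

  -- In each term the indices i and n - i add up to n, so p cannot divide both, and one of the two
  -- factors vanishes.
  ⊛-supported : ∀ {f h} → SupportedOnMultiples f → SupportedOnMultiples h →
                SupportedOnMultiples (f ⊛ h)
  ⊛-supported {f} {h} f-supp h-supp n p∤n = sum-zero (λ i → f (toℕ i) * h (n ℕ.∸ toℕ i)) term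
    where
    term : ∀ (i : Fin (suc n)) → f (toℕ i) * h (n ℕ.∸ toℕ i) ≈ 0ℂ
    term i with p ∣? toℕ i
    ... | no p∤i  = *-zeroˡ _ (f-supp (toℕ i) p∤i)
    -- Since `i : Fin (suc n)`, `toℕ i` is at most n and the truncated subtraction is exact.
    ... | yes p∣i = *-zeroʳ _ (h-supp (n ℕ.∸ toℕ i) λ p∣n∸i →
      p∤n (≡.subst (p ∣_) (ℕ.m+[n∸m]≡n (toℕ≤pred[n] i)) (∣m∣n⇒∣m+n p∣i p∣n∸i)))

  ^-supported : ∀ {f} → SupportedOnMultiples f → ∀ k → SupportedOnMultiples (f ^ k)
  ^-supported f-supp zero    = 1-supported
  ^-supported f-supp (suc k) = ⊛-supported f-supp (^-supported f-supp k)

  -- The coefficient at n is a finite combination of the coefficients at the same n of powers of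
  -- `f`.
  exp-supported : ∀ {f} (f₀≈0 : f 0 ≈ 0ℂ) → SupportedOnMultiples f →
                  SupportedOnMultiples (exp f f₀≈0)
  exp-supported f₀≈0 f-supp n p∤n = sum-zero {suc n} _ λ k →
    *-zeroʳ (fromℚ ((1ℤ ℚ./ (toℕ k !)) {{toℕ k ℕ.!≢0}})) (^-supported f-supp (toℕ k) n p∤n)

module _ (g : ArithmeticFunction) where

  möbiusTerm : (d e : ℕ) → .{{NonZero d}} → .{{NonZero e}} → ℂ
  möbiusTerm d e = fromℚ (μ d ℚ./ 1) * g e

  g-cong : ∀ {m n} .{{_ : NonZero m}} .{{_ : NonZero n}} → m ≡ n → g m ≈ g n
  g-cong ≡.refl = ≈-refl

  divisorTerm-1 : ∀ m .{{_ : NonZero m}} → divisorTerm m möbiusTerm 1 ≈ g m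
  divisorTerm-1 m with 1 ∣? m
  ... | no 1∤m  = contradiction (1∣ m) 1∤m
  -- `μ 1` evaluates to 1, so the scalar is `1ℂ` by computation; what remains is to identify the
  -- cofactor `q` with m.
  ... | yes (divides q m≡q*1) = ≈-trans (*-identityˡ (g q))
    (g-cong (≡.sym (≡.trans m≡q*1 (ℕ.*-identityʳ q))))
    where instance _ = quotient≢0 (divides q m≡q*1)

  g≈0 : ∀ p → (∀ m .{{_ : NonZero m}} → ¬ p ∣ m → β g m ≈ 0ℂ) →
        ∀ m .{{_ : NonZero m}} → ¬ p ∣ m → g m ≈ 0ℂ
  g≈0 p β≈0 m = <-rec P step m
    where
    P : ℕ → Set
    -- Both side conditions belong to the predicate, so the induction hypothesis can be applied to
    -- m/d with its own proofs of them.
    P m = .{{_ : NonZero m}} → ¬ p ∣ m → g m ≈ 0ℂ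

    step : ∀ m → (∀ {k} → k < m → P k) → P m
    step m@(suc k) ih p∤m = begin
      g m                       ≈⟨ divisorTerm-1 m ⟨
      term 1                    ≈⟨ +-identityʳ (term 1) ⟨
      -- As m is `suc k`, the divisor sum unfolds to the term at d = 1 and `k` further terms, with d
      -- running over 2, ..., m.
      term 1 + 0ℂ               ≈⟨ +-congˡ (sum-zero {k} _ λ i → term≈0 (suc (suc (toℕ i)))) ⟨
      ∑-divisors m möbiusTerm   ≈⟨ fromℚ-*-cancelˡ-≈0 (1ℤ ℚ./ m) {{1/m≢0 m}} (β≈0 m p∤m) ⟩
      0ℂ                        ∎
      where
      term : (d : ℕ) → .{{NonZero d}} → ℂ
      term = divisorTerm m möbiusTerm

      term≈0 : ∀ d .{{_ : NonZero d}} .{{_ : NonTrivial d}} → term d ≈ 0ℂ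
      term≈0 d with d ∣? m
      ... | no  _   = ≈-refl
      -- Here d > 1 gives m/d < m, and if p divided m/d it would divide m.
      ... | yes d∣m = let instance _ = quotient≢0 d∣m in
        *-zeroʳ _ (ih (quotient-< d∣m) λ p∣m/d → p∤m (∣-trans p∣m/d (quotient-∣ d∣m)))

theorem2p7 : (p : ℕ) → Prime p → (g : ArithmeticFunction) →
    ((m : ℕ) → .{{_ : NonZero m}} → ¬ (p ∣ m) → β g m ≈ 0ℂ) →
    (n : ℕ) → ¬ (p ∣ n) → a g n ≈ 0ℂ
theorem2p7 p _ g β≈0 = exp-supported p -0#≈0# exponent-supported
  where
  exponent-supported : SupportedOnMultiples p (exponent g)
  exponent-supported zero      p∤0 = contradiction (p ∣0) p∤0
  exponent-supported n@(suc _) p∤n =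
    ≈-trans (-‿cong (*-zeroʳ _ (g≈0 g p β≈0 n p∤n))) -0#≈0#
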